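{- For every $n\ge 0$ there is a bijection $\Phi$ between the set of involutions in $S_n$ avoiding $132$ and the set of words of length $n$ in $$P_{x,\overline{x}}=\{w\in\{x,\overline{x}\}^* : |w'|_x\ge |w'|_{\overline{x}}\text{ for every factorization } w=w'w''\}.$$ Moreover, $\Phi$ can be chosen so that for every $132$-avoiding involution $\pi$ the number of fixed points of $\pi$ equals $|\Phi(\pi)|_x-|\Phi(\pi)|_{\overline{x}}$.
   Context: $S_n$ is the set of permutations of $\{1,\dots,n\}$. A permutation $\alpha\in S_n$ contains a pattern $\tau\in S_k$ if there are $1\le i_1<\dots<i_k\le n$ such that $(\alpha_{i_1},\dots,\alpha_{i_k})$ is order-isomorphic to $\tau$; otherwise $\alpha$ avoids $\tau$. An involution is a permutation $\alpha$ with $\alpha(\alpha(i))=i$ for all $i$. For a word $w$ over the two-letter alphabet $\{x,\overline{x}\}$, $|w|_x$ and $|w|_{\overline{x}}$ denote the numbers of occurrences of the letters $x$ and $\overline{x}$ in $w$. The words in $P_{x,\overline{x}}$ are called primitive Dyck words in the paper. -}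

module Defs where

open import Data.Fin.Base using (Fin; _<_)
open import Data.Fin.Patterns using (1F; 2F)
open import Data.Fin.Permutation using (Permutation′; _⟨$⟩ʳ_; transpose)
import Data.Fin.Permutation as Perm
import Data.Fin.Properties as Fin
open import Data.List.Base using (List; length; filter; allFin; _++_)
open import Data.Nat.Base using (ℕ; _≥_)
open import Data.Product.Base using (∃-syntax; _×_)
open import Function.Base using (_∘_)
open import Function.Bundles using (_⇔_)
open import Level using (0ℓ)
open import Relation.Binary.Bundles using (Setoid)
open import Relation.Binary.Core using (_Preserves_⟶_)
open import Relation.Binary.Definitions using (DecidableEquality)
import Relation.Binary.Construct.On as On
open import Relation.Binary.PropositionalEquality
  using (_≡_; refl; sym; trans; setoid)
open import Relation.Nullary using (¬_; yes; no)

-- S_n is Permutation′ n, acting on Fin n = {0,…,n-1} rather than {1,…,n}.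

OrderIsomorphic : ∀ {k m n} → (Fin k → Fin m) → (Fin k → Fin n) → Set
OrderIsomorphic s t = ∀ a b → s a < s b ⇔ t a < t b

Contains : ∀ {n k} → Permutation′ n → Permutation′ k → Set
Contains {n} {k} α τ =
  ∃[ ι ] (ι Preserves _<_ ⟶ _<_) × OrderIsomorphic {k} {n} ((α ⟨$⟩ʳ_) ∘ ι) (τ ⟨$⟩ʳ_)

Avoids : ∀ {n k} → Permutation′ n → Permutation′ k → Set
Avoids α τ = ¬ Contains α τ

-- One-line notation 0 2 1 on Fin 3, i.e. 1 3 2 on {1,2,3}.
pattern132 : Permutation′ 3
pattern132 = transpose 1F 2F

IsInvolution : ∀ {n} → Permutation′ n → Set
IsInvolution α = ∀ i → α ⟨$⟩ʳ (α ⟨$⟩ʳ i) ≡ i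

record AvoidingInvolution (n : ℕ) : Set where
  field
    perm       : Permutation′ n
    involution : IsInvolution perm
    avoids     : Avoids perm pattern132

open AvoidingInvolution public

permutationSetoid : ℕ → Setoid 0ℓ 0ℓ
permutationSetoid n = record
  { Carrier       = Permutation′ n
  ; _≈_           = Perm._≈_
  ; isEquivalence = record
    { refl  = λ _ → refl
    ; sym   = λ p i → sym (p i)
    ; trans = λ p q i → trans (p i) (q i)
    }
  }

-- Elements are equal when their permutations agree pointwise; the proofs of
-- membership are ignored.
avoidingInvolutions : ℕ → Setoid 0ℓ 0ℓ
avoidingInvolutions n = On.setoid (permutationSetoid n) (perm {n})

fixedPoints : ∀ {n} → Permutation′ n → ℕ
fixedPoints {n} α = length (filter (λ i → α ⟨$⟩ʳ i Fin.≟ i) (allFin n))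

data Letter : Set where
  x x̄ : Letter

_≟_ : DecidableEquality Letter
x ≟ x = yes refl
x ≟ x̄ = no λ ()
x̄ ≟ x = no λ ()
x̄ ≟ x̄ = yes refl

Word : Set
Word = List Letter

∣_∣[_] : Word → Letter → ℕ
∣ w ∣[ a ] = length (filter (_≟ a) w)

-- Every prefix has at least as many x as x̄; the word itself need not be
-- balanced.
IsPrimitiveDyck : Word → Set
IsPrimitiveDyck w = ∀ w′ w″ → w ≡ w′ ++ w″ → ∣ w′ ∣[ x ] ≥ ∣ w′ ∣[ x̄ ]

record PrimitiveDyckWord (n : ℕ) : Set where
  field
    word          : Word
    length-word   : length word ≡ n
    primitiveDyck : IsPrimitiveDyck word

open PrimitiveDyckWord public

-- Elements are equal when their underlying words are.
primitiveDyckWords : ℕ → Setoid 0ℓ 0ℓ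
primitiveDyckWords n = On.setoid (setoid Word) (word {n})

{-# OPTIONS --safe #-}
module Submission where

-- A 132-avoiding involution has a unique pivot p: it maps everything before p
-- to p or beyond, and everything from p on is either fixed or sent before p.
-- (The pivot is the least i with f i ≤ i.)  Such involutions grow one element
-- at a time, always at the pivot.  Letter x inserts a fixed point at p.  Letter
-- x̄ inserts it and then joins it to the next fixed point in a 2-cycle, which
-- moves the pivot to p + 1 and is possible exactly when fixed points remain.
-- The last letter can be read back: it is x iff the element at the pivot is
-- fixed.  Hence the words are the ballot words, and x adds a fixed point while
-- x̄ removes one.

open import Defs
import Data.Nat.Base as ℕ
import Data.Nat.Properties as ℕ
open import Algebra.Properties.CommutativeMonoid.Sum ℕ.+-0-commutativeMonoid
  using (sum; sum-remove; sum-cong-≗; sum-replicate-zero; ∑-distrib-+)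
open import Data.Empty using (⊥)
open import Data.Fin.Base
  using (Fin; zero; suc; toℕ; fromℕ; fromℕ<; inject₁; punchIn; punchOut; _<_; _≤_)
open import Data.Fin.Patterns using (0F; 1F; 2F)
open import Data.Fin.Permutation
  using ( Permutation′; _⟨$⟩ʳ_; _≈_; _∘ₚ_; id; transpose; insert; remove
        ; insert-punchIn; punchIn-permute)
import Data.Fin.Permutation.Components as PC
import Data.Fin.Properties as Fin
open import Data.Integer.Base using (+_; _-_; _⊖_)
import Data.Integer.Properties as ℤ
open import Data.List.Base
  using (List; []; _∷_; _∷ʳ_; _++_; length; filter; tabulate; initLast; _∷ʳ′_)
import Data.List.Properties as List
open import Data.Nat.Base using (ℕ; zero; suc; _+_; z≤n; s≤s; z<s)
open import Data.Nat.Tactic.RingSolver using (solve-∀)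
open import Data.Product.Base using (Σ-syntax; ∃; ∃-syntax; _×_; _,_; proj₁; proj₂)
open import Function.Base using (_∘_)
open import Function.Bundles using (Bijection; Equivalence; _⇔_; mk⇔)
open import Relation.Binary.Definitions using (tri<; tri≈; tri>)
open import Relation.Binary.PropositionalEquality
  using (_≡_; _≢_; _≗_; refl; sym; trans; cong; cong₂; subst; subst₂; module ≡-Reasoning)
open import Relation.Nullary using (¬_; Dec; yes; no; contradiction)
open import Relation.Nullary.Decidable using (_×-dec_; dec-true; dec-false)
open import Relation.Unary using (Decidable)

-- Pivots of 132-avoiding involutions: uniqueness and existence.

private
  variable
    m n : ℕ

-- The pivot is a plain natural number, so a pivot at `suc (toℕ p)` needs no conversion between
-- `Fin` types. In `avoiding`, two value comparisons force the shape 132; the third follows by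
-- transitivity.
record Pivoted (a : ℕ) (f : Fin n → Fin n) : Set where
  field
    involutive : ∀ i → f (f i) ≡ i
    avoiding   : ∀ {i j k} → i < j → j < k → f i < f k → f k < f j → ⊥
    below      : ∀ {i} → toℕ i ℕ.< a → a ℕ.≤ toℕ (f i)
    above      : ∀ {i} → a ℕ.≤ toℕ i → a ℕ.≤ toℕ (f i) → f i ≡ i

  fixed⇒above : ∀ {i} → f i ≡ i → a ℕ.≤ toℕ i
  fixed⇒above {i} fi≡i with a ℕ.≤? toℕ i
  ... | yes a≤i = a≤i
  ... | no  a≰i = subst (λ j → a ℕ.≤ toℕ j) fi≡i (below (ℕ.≰⇒> a≰i))

open Pivoted

private
  variable
    a : ℕ
    f g h : Fin n → Fin n
    p q : Fin n

Pivoted-cong : f ≗ g → Pivoted a f → Pivoted a g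
Pivoted-cong {f = f} {g = g} {a = a} f≗g P = record
  { involutive = λ i → trans (sym (trans (cong f (f≗g i)) (f≗g (g i)))) (P .involutive i)
  ; avoiding   = λ {i} {j} {k} i<j j<k gi<gk gk<gj → P .avoiding i<j j<k
      (subst₂ _<_ (sym (f≗g i)) (sym (f≗g k)) gi<gk)
      (subst₂ _<_ (sym (f≗g k)) (sym (f≗g j)) gk<gj)
  ; below      = λ {i} i<a → subst (λ j → a ℕ.≤ toℕ j) (f≗g i) (P .below i<a)
  ; above      = λ {i} a≤i a≤gi → trans (sym (f≗g i))
      (P .above a≤i (subst (λ j → a ℕ.≤ toℕ j) (sym (f≗g i)) a≤gi))
  }

-- With pivot `q`, the element at `p` is sent to `q` or beyond. With pivot `p`, it is then fixed,
-- which gives `q ≤ p`. Since `p < q ≤ n`, the index `p` does name an element of `Fin n`.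
pivot-≮ : {f : Fin n → Fin n} {p q : Fin (suc n)} →
          Pivoted (toℕ p) f → Pivoted (toℕ q) f → ¬ p < q
pivot-≮ {n} {f} {p} {q} P Q p<q = ℕ.<-irrefl refl (ℕ.<-≤-trans p<q q≤p)
  where
  p<n = ℕ.<-≤-trans p<q (ℕ.≤-pred (Fin.toℕ<n q))
  i = fromℕ< p<n
  i≡p : toℕ i ≡ toℕ p
  i≡p = Fin.toℕ-fromℕ< p<n
  q≤fi = Q .below (subst (ℕ._< toℕ q) (sym i≡p) p<q)
  fi≡i = P .above (ℕ.≤-reflexive (sym i≡p)) (ℕ.≤-trans (ℕ.<⇒≤ p<q) q≤fi)
  q≤p : toℕ q ℕ.≤ toℕ p
  q≤p = subst (toℕ q ℕ.≤_) (trans (cong toℕ fi≡i) i≡p) q≤fi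

pivot-unique : {f : Fin n → Fin n} {p q : Fin (suc n)} →
               Pivoted (toℕ p) f → Pivoted (toℕ q) f → p ≡ q
pivot-unique {p = p} {q = q} P Q with Fin.<-cmp p q
... | tri< p<q _ _ = contradiction p<q (pivot-≮ P Q)
... | tri≈ _ p≡q _ = p≡q
... | tri> _ _ q<p = contradiction q<p (pivot-≮ Q P)

least : {P : Fin n → Set} → Decidable P → ∃ P → ∃[ i ] P i × (∀ {j} → P j → i ≤ j)
least {suc n} P? (i , Pi) with P? zero
least {suc n} P? (i , Pi) | yes P0 = zero , P0 , λ _ → z≤n
least {suc n} P? (zero , P0) | no ¬P0 = contradiction P0 ¬P0
least {suc n} {P} P? (suc i , Pi) | no ¬P0 with least {P = P ∘ suc} (P? ∘ suc) (i , Pi)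
... | l , Pl , minimal = suc l , Pl , λ {j} → minimal′ j
  where
  minimal′ : ∀ j → P j → suc l ≤ j
  minimal′ zero    P0 = contradiction P0 ¬P0
  minimal′ (suc j) Pj = s≤s (minimal Pj)

pivoted-empty : {f : Fin 0 → Fin 0} → Pivoted 0 f
pivoted-empty = record
  { involutive = λ () ; avoiding = λ { {()} } ; below = λ () ; above = λ { {()} } }

pivot-exists : (f : Fin n → Fin n) → (∀ i → f (f i) ≡ i) →
               (∀ {i j k} → i < j → j < k → f i < f k → f k < f j → ⊥) →
               Σ[ p ∈ Fin (suc n) ] Pivoted (toℕ p) f
pivot-exists {zero}  f inv av = zero , pivoted-empty
pivot-exists {suc n} f inv av = inject₁ l , subst (λ a → Pivoted a f) (sym (Fin.toℕ-inject₁ l)) (record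
  { involutive = inv
  ; avoiding   = av
  ; below      = below′
  ; above      = above′
  })
  where
  -- The last element satisfies the condition, so the search for the least one succeeds.
  smallest = least (λ i → f i Fin.≤? i) (fromℕ n , Fin.≤fromℕ (f (fromℕ n)))
  l = proj₁ smallest
  fl≤l = proj₁ (proj₂ smallest)
  minimal = proj₂ (proj₂ smallest)

  raised : ∀ {i} → i < l → i < f i
  raised i<l = ℕ.≰⇒> λ fi≤i → ℕ.<⇒≱ i<l (minimal fi≤i)

  -- If `f i < l`, then `f i` is raised as well, so `f i < f (f i) = i`, against `i < f i`.
  below′ : ∀ {i} → i < l → l ≤ f i
  below′ {i} i<l with l Fin.≤? f i
  ... | yes l≤fi = l≤fi
  ... | no  l≰fi = contradiction
    (subst (f i <_) (inv i) (raised (ℕ.≰⇒> l≰fi)))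
    (ℕ.<-asym (raised i<l))

  -- If `l < i < f i`, the positions `l`, `i`, `f i` carry the values `f l ≤ l`, `f i`, `i`, which
  -- is a 132.
  not-raised : ∀ {i} → l ≤ i → ¬ i < f i
  not-raised {i} l≤i i<fi with l Fin.≟ i
  ... | yes refl = ℕ.<⇒≱ i<fi fl≤l
  ... | no  l≢i  = av l<i i<fi
    (subst (f l <_) (sym (inv i)) (ℕ.≤-<-trans fl≤l l<i))
    (subst (_< f i) (sym (inv i)) i<fi)
    where l<i = Fin.≤∧≢⇒< l≤i l≢i

  above′ : ∀ {i} → l ≤ i → l ≤ f i → f i ≡ i
  above′ {i} l≤i l≤fi = Fin.≤-antisym
    (ℕ.≮⇒≥ (not-raised l≤i))
    (ℕ.≮⇒≥ λ fi<i → not-raised l≤fi (subst (f i <_) (sym (inv i)) fi<i))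

-- Inserting and removing a fixed point at the pivot.

punchIn-< : (p : Fin (suc n)) {i : Fin n} → toℕ i ℕ.< toℕ p → punchIn p i < p
punchIn-< (suc p) {zero}  _         = z<s
punchIn-< (suc p) {suc i} (s≤s i<p) = s≤s (punchIn-< p i<p)

punchIn-> : (p : Fin (suc n)) {i : Fin n} → toℕ p ℕ.≤ toℕ i → p < punchIn p i
punchIn-> zero    _                 = z<s
punchIn-> (suc p) {suc i} (s≤s p≤i) = s≤s (punchIn-> p p≤i)

punchIn-cancel-<p : (p : Fin (suc n)) {i : Fin n} → punchIn p i < p → toℕ i ℕ.< toℕ p
punchIn-cancel-<p p {i} ei<p = ℕ.≰⇒> λ p≤i → ℕ.<-asym ei<p (punchIn-> p p≤i)

punchIn-cancel->p : (p : Fin (suc n)) {i : Fin n} → p ≤ punchIn p i → toℕ p ℕ.≤ toℕ i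
punchIn-cancel->p p {i} p≤ei = ℕ.≮⇒≥ λ i<p → ℕ.<⇒≱ (punchIn-< p i<p) p≤ei

punchIn-mono-< : (p : Fin (suc n)) {i j : Fin n} → i < j → punchIn p i < punchIn p j
punchIn-mono-< p {i} {j} i<j = ℕ.≰⇒> λ ej≤ei → ℕ.<⇒≱ i<j (Fin.punchIn-cancel-≤ p j i ej≤ei)

punchIn-cancel-< : (p : Fin (suc n)) {i j : Fin n} → punchIn p i < punchIn p j → i < j
punchIn-cancel-< p {i} {j} ei<ej = ℕ.≰⇒> λ j≤i → ℕ.<⇒≱ ei<ej (Fin.punchIn-mono-≤ p j i j≤i)

data PunchInView (p : Fin (suc n)) : Fin (suc n) → Set where
  hole    : PunchInView p p
  punched : ∀ i → PunchInView p (punchIn p i)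

punchInView : (p i : Fin (suc n)) → PunchInView p i
punchInView p i with p Fin.≟ i
... | yes refl = hole
... | no  p≢i  = subst (PunchInView p) (Fin.punchIn-punchOut p≢i) (punched (punchOut p≢i))

-- A relation between functions, so that it applies both to `insert` and to `remove`.
record Inserted (p : Fin (suc n)) (f : Fin n → Fin n) (g : Fin (suc n) → Fin (suc n)) : Set where
  field
    fixes-hole : g p ≡ p
    on-punched : ∀ i → g (punchIn p i) ≡ punchIn p (f i)

open Inserted

-- A 132 cannot use the new fixed point. If it came first, the other two entries would lie after `p`
-- with values beyond `p`, hence be fixed and increasing. If it came second or third, the first
-- entry would lie before `p` and yet have a value below `p`.
insert-pivoted : {p : Fin (suc n)} → Inserted p f g → Pivoted (toℕ p) f → Pivoted (toℕ p) g
insert-pivoted {f = f} {g = g} {p = p} I P = record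
  { involutive = inv
  ; avoiding   = λ {i} {j} {k} → av (punchInView p i) (punchInView p j) (punchInView p k)
  ; below      = λ {i} → below′ (punchInView p i)
  ; above      = λ {i} → above′ (punchInView p i)
  }
  where
  e = punchIn p
  gp = I .fixes-hole
  ge = I .on-punched

  inv : ∀ i → g (g i) ≡ i
  inv i with punchInView p i
  ... | hole      = trans (cong g gp) gp
  ... | punched j = trans (cong g (ge j)) (trans (ge (f j)) (cong e (P .involutive j)))

  below′ : ∀ {i} → PunchInView p i → i < p → p ≤ g i
  below′ hole        p<p  = contradiction p<p (ℕ.<-irrefl refl)
  below′ (punched i) ei<p = subst (p ≤_) (sym (ge i))
    (ℕ.<⇒≤ (punchIn-> p (P .below (punchIn-cancel-<p p ei<p))))

  above′ : ∀ {i} → PunchInView p i → p ≤ i → p ≤ g i → g i ≡ i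
  above′ hole        _    _     = gp
  above′ (punched i) p≤ei p≤gei = trans (ge i) (cong e (P .above (punchIn-cancel->p p p≤ei)
    (punchIn-cancel->p p (subst (p ≤_) (ge i) p≤gei))))

  av : ∀ {i j k} → PunchInView p i → PunchInView p j → PunchInView p k →
       i < j → j < k → g i < g k → g k < g j → ⊥
  av {i} {j} {k} hole vj vk p<j j<k gp<gk gk<gj = ℕ.<-asym j<k
    (subst₂ _<_
      (above′ vk (ℕ.<⇒≤ (ℕ.<-trans p<j j<k)) (ℕ.<⇒≤ p<gk))
      (above′ vj (ℕ.<⇒≤ p<j) (ℕ.<⇒≤ (ℕ.<-trans p<gk gk<gj)))
      gk<gj)
    where p<gk = subst (_< g k) gp gp<gk
  av {i} {j} {k} vi hole vk i<p p<k gi<gk gk<gp =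
    ℕ.<⇒≱ (ℕ.<-trans gi<gk (subst (g k <_) gp gk<gp)) (below′ vi i<p)
  av {i} {j} {k} vi vj hole i<j j<p gi<gp gp<gj =
    ℕ.<⇒≱ (subst (g i <_) gp gi<gp) (below′ vi (ℕ.<-trans i<j j<p))
  av (punched i) (punched j) (punched k) i<j j<k gi<gk gk<gj = P .avoiding
    (punchIn-cancel-< p i<j) (punchIn-cancel-< p j<k)
    (punchIn-cancel-< p (subst₂ _<_ (ge i) (ge k) gi<gk))
    (punchIn-cancel-< p (subst₂ _<_ (ge k) (ge j) gk<gj))

remove-pivoted : {p : Fin (suc n)} → Inserted p f g → Pivoted (toℕ p) g → Pivoted (toℕ p) f
remove-pivoted {f = f} {g = g} {p = p} I P = record
  { involutive = λ i → Fin.punchIn-injective p _ _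
      (trans (sym (ge (f i))) (trans (cong g (sym (ge i))) (P .involutive (e i))))
  ; avoiding   = λ {i} {j} {k} i<j j<k fi<fk fk<fj → P .avoiding
      (punchIn-mono-< p i<j) (punchIn-mono-< p j<k)
      (subst₂ _<_ (sym (ge i)) (sym (ge k)) (punchIn-mono-< p fi<fk))
      (subst₂ _<_ (sym (ge k)) (sym (ge j)) (punchIn-mono-< p fk<fj))
  ; below      = λ {i} i<p → punchIn-cancel->p p
      (subst (p ≤_) (ge i) (P .below (punchIn-< p i<p)))
  ; above      = λ {i} p≤i p≤fi → Fin.punchIn-injective p _ _ (trans (sym (ge i))
      (P .above (ℕ.<⇒≤ (punchIn-> p p≤i))
        (subst (p ≤_) (sym (ge i)) (ℕ.<⇒≤ (punchIn-> p p≤fi)))))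
  }
  where
  e = punchIn p
  ge = I .on-punched

-- Joining two fixed points in a 2-cycle.

NextFixed : (Fin n → Fin n) → Fin n → Fin n → Set
NextFixed h p q = p < q × h q ≡ q × (∀ {i} → p < i → h i ≡ i → q ≤ i)

-- Used in both directions: to create the 2-cycle, going from `h` to `f`, and to dissolve it, going
-- from `f` to `h`.
record Swapped (p q : Fin n) (h f : Fin n → Fin n) : Set where
  field
    hp   : h p ≡ p
    hq   : h q ≡ q
    fp   : f p ≡ q
    fq   : f q ≡ p
    same : ∀ {i} → i ≢ p → i ≢ q → h i ≡ f i

data SwapView (p q : Fin n) : Fin n → Set where
  first  : SwapView p q p
  second : SwapView p q q
  other  : ∀ {i} → i ≢ p → i ≢ q → SwapView p q i

swapView : (p q i : Fin n) → SwapView p q i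
swapView p q i with i Fin.≟ p | i Fin.≟ q
... | yes refl | _        = first
... | no  _    | yes refl = second
... | no  i≢p  | no  i≢q  = other i≢p i≢q

>⇒≢ : {i j : Fin n} → j < i → i ≢ j
>⇒≢ j<i refl = ℕ.<-irrefl refl j<i

module _ {p q : Fin n} {h f : Fin n → Fin n} (S : Swapped p q h f) where
  open Swapped S

  -- Joining the pivot to the next fixed point moves the pivot to `p + 1`.

  module _ (H : Pivoted (toℕ p) h) (next : NextFixed h p q) where
    private
      p<q = proj₁ next

      inv : ∀ i → f (f i) ≡ i
      inv i with swapView p q i
      ... | first  = trans (cong f fp) fq
      ... | second = trans (cong f fq) fp
      ... | other i≢p i≢q = trans (sym (same fi≢p fi≢q)) (trans (cong h (sym hi≡fi)) (H .involutive i))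
        where
        hi≡fi = same i≢p i≢q
        back : ∀ {j} → h j ≡ j → f i ≡ j → i ≡ j
        back hj fi≡j = trans (sym (H .involutive i)) (trans (cong h (trans hi≡fi fi≡j)) hj)
        fi≢p = λ fi≡p → i≢p (back hp fi≡p)
        fi≢q = λ fi≡q → i≢q (back hq fi≡q)

      below′ : ∀ {i} → i ≤ p → p < f i
      below′ {i} i≤p with swapView p q i
      ... | first  = subst (p <_) (sym fp) p<q
      ... | second = contradiction i≤p (ℕ.<⇒≱ p<q)
      ... | other i≢p i≢q = Fin.≤∧≢⇒<
        (subst (p ≤_) (same i≢p i≢q) (H .below (Fin.≤∧≢⇒< i≤p i≢p)))
        (λ p≡fi → i≢p (trans (sym (H .involutive i)) (trans (cong h (trans (same i≢p i≢q) (sym p≡fi))) hp)))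

      above′ : ∀ {i} → p < i → p < f i → f i ≡ i
      above′ {i} p<i p<fi with swapView p q i
      ... | first  = contradiction p<i (ℕ.<-irrefl refl)
      ... | second = contradiction (subst (p <_) fq p<fi) (ℕ.<-irrefl refl)
      ... | other i≢p i≢q = trans (sym hi≡fi)
        (H .above (ℕ.<⇒≤ p<i) (subst (p ≤_) (sym hi≡fi) (ℕ.<⇒≤ p<fi)))
        where hi≡fi = same i≢p i≢q

    -- A fixed point of `f` is neither `p` nor `q`, so `h` fixes it too. It therefore lies past the
    -- pivot `p`, and `q` was the nearest such point.
    swap-fixed⇒> : ∀ {i} → f i ≡ i → q < i
    swap-fixed⇒> {i} fi≡i with swapView p q i
    ... | first  = contradiction (trans (sym fp) fi≡i) (>⇒≢ p<q)
    ... | second = contradiction (trans (sym fi≡i) fq) (>⇒≢ p<q)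
    ... | other i≢p i≢q = Fin.≤∧≢⇒<
      (proj₂ (proj₂ next) (Fin.≤∧≢⇒< (fixed⇒above H hi≡i) (i≢p ∘ sym)) hi≡i)
      (i≢q ∘ sym)
      where hi≡i = trans (same i≢p i≢q) fi≡i

    private
      av-others : ∀ {i j k} → i ≢ p → i ≢ q → j ≢ p → j ≢ q → k ≢ p → k ≢ q →
                  i < j → j < k → f i < f k → f k < f j → ⊥
      av-others i≢p i≢q j≢p j≢q k≢p k≢q i<j j<k fi<fk fk<fj = H .avoiding i<j j<k
        (subst₂ _<_ (sym (same i≢p i≢q)) (sym (same k≢p k≢q)) fi<fk)
        (subst₂ _<_ (sym (same k≢p k≢q)) (sym (same j≢p j≢q)) fk<fj)

      <p⇒≢p : ∀ {i} → i < p → i ≢ p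
      <p⇒≢p i<p i≡p = >⇒≢ i<p (sym i≡p)

      <p⇒≢q : ∀ {i} → i < p → i ≢ q
      <p⇒≢q i<p i≡q = >⇒≢ (ℕ.<-trans i<p p<q) (sym i≡q)

      -- A pattern ending at p in f becomes one ending at q in h, as f p = q = h q.
      av-low : ∀ {i j k} → i < j → j < k → k ≤ p → f i < f k → f k < f j → ⊥
      av-low {i} {j} {k} i<j j<k k≤p fi<fk fk<fj with k Fin.≟ p
      ... | yes refl = H .avoiding i<j (ℕ.<-trans j<k p<q)
        (subst₂ _<_ (sym (same (<p⇒≢p i<p) (<p⇒≢q i<p))) (trans fp (sym hq)) fi<fk)
        (subst₂ _<_ (trans fp (sym hq)) (sym (same (<p⇒≢p j<k) (<p⇒≢q j<k))) fk<fj)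
        where i<p = ℕ.<-trans i<j j<k
      ... | no  k≢p  = av-others (<p⇒≢p i<p) (<p⇒≢q i<p) (<p⇒≢p j<p) (<p⇒≢q j<p) k≢p (<p⇒≢q k<p)
          i<j j<k fi<fk fk<fj
        where
        k<p = Fin.≤∧≢⇒< k≤p k≢p
        j<p = ℕ.<-trans j<k k<p
        i<p = ℕ.<-trans i<j j<p

      -- If `f k` is `p`, then `k` is `q`, and `j` lies past `p` with a value past `p`; so `j` is
      -- fixed and must lie past `q`, against `j < k`. If `f k` is below `p`, neither `i` nor `k` is
      -- `p` or `q`. Should `j` be `q`, its value rises from `p` in `f` to `q` in `h`, and the
      -- pattern survives in `h`.
      av-low-value : ∀ {i j k} → i < j → j < k → f k ≤ p → f i < f k → f k < f j → ⊥
      av-low-value {i} {j} {k} i<j j<k fk≤p fi<fk fk<fj with f k Fin.≟ p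
      ... | yes fk≡p = ℕ.<-asym j<k (subst (_< j) (sym k≡q) (swap-fixed⇒> fj≡j))
        where
        k≡q : k ≡ q
        k≡q = trans (sym (inv k)) (trans (cong f fk≡p) fp)
        p<i = ℕ.≰⇒> λ i≤p → ℕ.<-asym (below′ i≤p) (subst (f i <_) fk≡p fi<fk)
        fj≡j = above′ (ℕ.<-trans p<i i<j) (subst (_< f j) fk≡p fk<fj)
      ... | no  fk≢p = finish (j Fin.≟ q)
        where
        fk<p = Fin.≤∧≢⇒< fk≤p fk≢p
        fi<p = ℕ.<-trans fi<fk fk<p
        value<p⇒p< : ∀ {l} → f l < p → p < l
        value<p⇒p< fl<p = ℕ.≰⇒> λ l≤p → ℕ.<-asym (below′ l≤p) fl<p
        p<i = value<p⇒p< fi<p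
        value<p⇒≢q : ∀ {l} → f l < p → l ≢ q
        value<p⇒≢q fl<p refl = <p⇒≢p fl<p fq
        p<j = ℕ.<-trans p<i i<j
        p<k = ℕ.<-trans p<j j<k
        i≢p = >⇒≢ p<i
        i≢q = value<p⇒≢q fi<p
        k≢p = >⇒≢ p<k
        k≢q = value<p⇒≢q fk<p
        finish : Dec (j ≡ q) → ⊥
        finish (no  j≢q)  = av-others i≢p i≢q (>⇒≢ p<j) j≢q k≢p k≢q i<j j<k fi<fk fk<fj
        finish (yes refl) = H .avoiding i<j j<k
          (subst₂ _<_ (sym (same i≢p i≢q)) (sym (same k≢p k≢q)) fi<fk)
          (subst₂ _<_ (sym (same k≢p k≢q)) (sym hq) (ℕ.<-trans fk<p p<q))

      av : ∀ {i j k} → i < j → j < k → f i < f k → f k < f j → ⊥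
      av {i} {j} {k} i<j j<k fi<fk fk<fj with k Fin.≤? p | f k Fin.≤? p
      ... | yes k≤p | _        = av-low i<j j<k k≤p fi<fk fk<fj
      ... | no  _   | yes fk≤p = av-low-value i<j j<k fk≤p fi<fk fk<fj
      -- Here `k` is fixed and lies past `q`. If `j` were past `p` it would be fixed too, against
      -- `k < f j`; and `j` is not `p`, whose value `q` is below `k`. So the pattern avoids both
      -- swapped points and is already in `h`.
      ... | no  k≰p | no  fk≰p = av-others (<p⇒≢p i<p) (<p⇒≢q i<p) j≢p (<p⇒≢q j<p)
          (>⇒≢ (ℕ.≰⇒> k≰p)) (>⇒≢ q<k) i<j j<k fi<fk fk<fj
        where
        fk≡k = above′ (ℕ.≰⇒> k≰p) (ℕ.≰⇒> fk≰p)
        q<k = swap-fixed⇒> fk≡k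
        k<fj = subst (_< f j) fk≡k fk<fj
        p<fj = ℕ.<-trans (ℕ.<-trans p<q q<k) k<fj
        j≤p = ℕ.≮⇒≥ λ p<j → ℕ.<-asym j<k (subst (k <_) (above′ p<j p<fj) k<fj)
        j≢p : j ≢ p
        j≢p refl = ℕ.<-asym q<k (subst (k <_) fp k<fj)
        j<p = Fin.≤∧≢⇒< j≤p j≢p
        i<p = ℕ.<-trans i<j j<p

    swap-pivoted : Pivoted (suc (toℕ p)) f
    swap-pivoted = record
      { involutive = inv
      ; avoiding   = av
      ; below      = λ i<1+p → below′ (ℕ.≤-pred i<1+p)
      ; above      = above′
      }

  -- Dissolving the 2-cycle moves the pivot back to `p`.

  module _ (F : Pivoted (suc (toℕ p)) f) (moves : ∀ s → toℕ s ≡ suc (toℕ p) → f s ≢ s) where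
    private
      p<q : p < q
      p<q = subst (p <_) fp (F .below (ℕ.n<1+n _))

      -- A fixed point i strictly between p and q would form a 132 in f at p + 1, i, q.
      minimal : ∀ {i} → p < i → h i ≡ i → q ≤ i
      minimal {i} p<i hi≡i = ℕ.≮⇒≥ λ i<q →
        let
          fi≡i = trans (sym (same (>⇒≢ p<i) (λ i≡q → >⇒≢ i<q (sym i≡q)))) hi≡i
          s≢i  = λ s≡i → fs≢s (subst (λ j → f j ≡ j) (sym s≡i) fi≡i)
          s<i  = Fin.≤∧≢⇒< (subst (ℕ._≤ toℕ i) (sym s≡1+p) p<i) s≢i
          fs≢p = λ fs≡p → >⇒≢ (ℕ.<-trans s<i i<q)
                   (trans (sym fp) (trans (cong f (sym fs≡p)) (F .involutive s)))
        in F .avoiding s<i i<q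
          (subst (f s <_) (sym fq) (Fin.≤∧≢⇒< fs≤p fs≢p))
          (subst₂ _<_ (sym fq) (sym fi≡i) p<i)
        where
        1+p<n = ℕ.≤-<-trans p<i (Fin.toℕ<n i)
        s = fromℕ< 1+p<n
        s≡1+p : toℕ s ≡ suc (toℕ p)
        s≡1+p = Fin.toℕ-fromℕ< 1+p<n
        fs≢s = moves s s≡1+p
        fs≤p : f s ≤ p
        fs≤p = ℕ.≮⇒≥ λ p<fs → fs≢s (F .above (ℕ.≤-reflexive (sym s≡1+p)) p<fs)

    unswap-next : NextFixed h p q
    unswap-next = p<q , hq , minimal

    private
      inv : ∀ i → h (h i) ≡ i
      inv i with swapView p q i
      ... | first  = trans (cong h hp) hp
      ... | second = trans (cong h hq) hq
      ... | other i≢p i≢q = trans (cong h hi≡fi) (trans (same fi≢p fi≢q) (F .involutive i))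
        where
        hi≡fi = same i≢p i≢q
        fi≢p = λ fi≡p → i≢q (trans (sym (F .involutive i)) (trans (cong f fi≡p) fp))
        fi≢q = λ fi≡q → i≢p (trans (sym (F .involutive i)) (trans (cong f fi≡q) fq))

      below′ : ∀ {i} → i < p → p ≤ h i
      below′ {i} i<p with swapView p q i
      ... | first  = contradiction i<p (ℕ.<-irrefl refl)
      ... | second = contradiction i<p (ℕ.<-asym p<q)
      ... | other i≢p i≢q = subst (p ≤_) (sym (same i≢p i≢q)) (ℕ.<⇒≤ (F .below (ℕ.m<n⇒m<1+n i<p)))

      above′ : ∀ {i} → p ≤ i → p ≤ h i → h i ≡ i
      above′ {i} p≤i p≤hi with swapView p q i
      ... | first  = hp
      ... | second = hq
      ... | other i≢p i≢q = trans hi≡fi (F .above (Fin.≤∧≢⇒< p≤i (i≢p ∘ sym))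
          (Fin.≤∧≢⇒< (subst (p ≤_) hi≡fi p≤hi) (fi≢p ∘ sym)))
        where
        hi≡fi = same i≢p i≢q
        fi≢p = λ fi≡p → i≢q (trans (sym (F .involutive i)) (trans (cong f fi≡p) fp))

      <p⇒hi≡fi : ∀ {i} → i < p → h i ≡ f i
      <p⇒hi≡fi i<p = same (λ i≡p → >⇒≢ i<p (sym i≡p)) (λ i≡q → >⇒≢ (ℕ.<-trans i<p p<q) (sym i≡q))

      h-value<p : ∀ {i} → h i < p → h i ≡ f i
      h-value<p {i} hi<p = same
        (λ { refl → ℕ.<-irrefl (cong toℕ hp) hi<p })
        (λ { refl → ℕ.<-asym p<q (subst (_< p) hq hi<p) })

      av : ∀ {i j k} → i < j → j < k → h i < h k → h k < h j → ⊥
      av {i} {j} {k} i<j j<k hi<hk hk<hj with i Fin.<? p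
      -- All three values are at least `p`. Then `j` lies before `p`, since otherwise `j` and `k`
      -- would both be fixed and in order. If `k` is `q`, the position `p` replaces it in `f`,
      -- because `f p = q = h q`.
      ... | yes i<p = finish (swapView p q k)
        where
        p≤hi = below′ i<p
        p<hk = ℕ.≤-<-trans p≤hi hi<hk
        p<hj = ℕ.<-trans p<hk hk<hj
        j<p = ℕ.≰⇒> λ p≤j → ℕ.<-asym j<k (subst₂ _<_
          (above′ (ℕ.≤-trans p≤j (ℕ.<⇒≤ j<k)) (ℕ.<⇒≤ p<hk))
          (above′ p≤j (ℕ.<⇒≤ p<hj)) hk<hj)
        finish : SwapView p q k → ⊥
        finish first  = ℕ.<-irrefl (cong toℕ (sym hp)) p<hk
        finish second = F .avoiding i<j j<p
          (subst₂ _<_ (<p⇒hi≡fi i<p) (trans hq (sym fp)) hi<hk)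
          (subst₂ _<_ (trans hq (sym fp)) (<p⇒hi≡fi j<p) hk<hj)
        finish (other k≢p k≢q) = F .avoiding i<j j<k
          (subst₂ _<_ (<p⇒hi≡fi i<p) (same k≢p k≢q) hi<hk)
          (subst₂ _<_ (same k≢p k≢q) (<p⇒hi≡fi j<p) hk<hj)
      -- All three positions are at or after `p`, so `h k` is below `p`: otherwise `j` and `k` would
      -- be fixed and in order. Values below `p` are the same in `h` and `f`. If `j` is `q`, its
      -- value drops to `p` in `f`, still above `h k`.
      ... | no  i≮p = F .avoiding i<j j<k
          (subst₂ _<_ (h-value<p hi<p) (h-value<p hk<p) hi<hk)
          (subst (_< f j) (h-value<p hk<p) (hk<fj (swapView p q j)))
        where
        p≤i = ℕ.≮⇒≥ i≮p
        p<j = ℕ.≤-<-trans p≤i i<j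
        p<k = ℕ.<-trans p<j j<k
        hk<p = ℕ.≰⇒> λ p≤hk → ℕ.<-asym j<k (subst₂ _<_
          (above′ (ℕ.<⇒≤ p<k) p≤hk)
          (above′ (ℕ.<⇒≤ p<j) (ℕ.<⇒≤ (ℕ.≤-<-trans p≤hk hk<hj))) hk<hj)
        hi<p = ℕ.<-trans hi<hk hk<p
        hk<fj : SwapView p q j → h k < f j
        hk<fj first           = contradiction p<j (ℕ.<-irrefl refl)
        hk<fj second          = subst (h k <_) (sym fq) hk<p
        hk<fj (other j≢p j≢q) = subst (h k <_) (same j≢p j≢q) hk<hj

    unswap-pivoted : Pivoted (toℕ p) h
    unswap-pivoted = record
      { involutive = inv
      ; avoiding   = av
      ; below      = below′
      ; above      = above′
      }

-- Insertions and swaps realised by permutations.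

module TransposeProperties (p q : Fin n) where
  first↦second : PC.transpose p q p ≡ q
  first↦second rewrite dec-true (p Fin.≟ p) refl = refl

  second↦first : PC.transpose p q q ≡ p
  second↦first with q Fin.≟ p
  ... | yes q≡p = q≡p
  ... | no  _ rewrite dec-true (q Fin.≟ q) refl = refl

  other↦other : ∀ {i} → i ≢ p → i ≢ q → PC.transpose p q i ≡ i
  other↦other {i} i≢p i≢q
    rewrite dec-false (i Fin.≟ p) i≢p | dec-false (i Fin.≟ q) i≢q = refl

transpose-swapped : (f : Fin n → Fin n) {p q : Fin n} → f p ≡ p → f q ≡ q →
                    Swapped p q f (f ∘ PC.transpose p q)
transpose-swapped f {p} {q} fp fq = record
  { hp   = fp
  ; hq   = fq
  ; fp   = trans (cong f first↦second) fq
  ; fq   = trans (cong f second↦first) fp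
  ; same = λ i≢p i≢q → cong f (sym (other↦other i≢p i≢q))
  }
  where
  open TransposeProperties p q

transpose-unswapped : (f : Fin n → Fin n) {p q : Fin n} → f p ≡ q → f q ≡ p →
                      Swapped p q (f ∘ PC.transpose p q) f
transpose-unswapped f {p} {q} fp fq = record
  { hp   = trans (cong f first↦second) fq
  ; hq   = trans (cong f second↦first) fp
  ; fp   = fp
  ; fq   = fq
  ; same = λ i≢p i≢q → cong f (other↦other i≢p i≢q)
  }
  where
  open TransposeProperties p q

insert-inserted : (p : Fin (suc n)) (π : Permutation′ n) → Inserted p (π ⟨$⟩ʳ_) (insert p p π ⟨$⟩ʳ_)
insert-inserted p π = record { fixes-hole = fixes ; on-punched = insert-punchIn p p π }
  where
  fixes : insert p p π ⟨$⟩ʳ p ≡ p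
  fixes with p Fin.≟ p
  ... | yes _   = refl
  ... | no  p≢p = contradiction refl p≢p

remove-inserted : {p : Fin (suc n)} (σ : Permutation′ (suc n)) → σ ⟨$⟩ʳ p ≡ p →
                  Inserted p (remove p σ ⟨$⟩ʳ_) (σ ⟨$⟩ʳ_)
remove-inserted {p = p} σ σp≡p = record
  { fixes-hole = σp≡p
  ; on-punched = λ i → trans (punchIn-permute σ p i) (cong (λ j → punchIn j (remove p σ ⟨$⟩ʳ i)) σp≡p)
  }

inserted-cong : {p : Fin (suc n)} {f f′ : Fin n → Fin n} {g g′ : Fin (suc n) → Fin (suc n)} →
                Inserted p f g → Inserted p f′ g′ → f ≗ f′ → g ≗ g′
inserted-cong {p = p} I I′ f≗f′ i with punchInView p i
... | hole      = trans (I .fixes-hole) (sym (I′ .fixes-hole))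
... | punched j = trans (I .on-punched j) (trans (cong (punchIn p) (f≗f′ j)) (sym (I′ .on-punched j)))

inserted-injective : {p : Fin (suc n)} {f f′ : Fin n → Fin n} {g g′ : Fin (suc n) → Fin (suc n)} →
                     Inserted p f g → Inserted p f′ g′ → g ≗ g′ → f ≗ f′
inserted-injective {p = p} I I′ g≗g′ i = Fin.punchIn-injective p _ _
  (trans (sym (I .on-punched i)) (trans (g≗g′ (punchIn p i)) (I′ .on-punched i)))

swapped-cong : {f f′ h h′ : Fin n → Fin n} → Swapped p q h f → Swapped p q h′ f′ → h ≗ h′ → f ≗ f′
swapped-cong {p = p} {q = q} S S′ h≗h′ i with swapView p q i
... | first         = trans (S .Swapped.fp) (sym (S′ .Swapped.fp))
... | second        = trans (S .Swapped.fq) (sym (S′ .Swapped.fq))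
... | other i≢p i≢q = trans (sym (S .Swapped.same i≢p i≢q)) (trans (h≗h′ i) (S′ .Swapped.same i≢p i≢q))

swapped-injective : {f f′ h h′ : Fin n → Fin n} → Swapped p q h f → Swapped p q h′ f′ → f ≗ f′ → h ≗ h′
swapped-injective {p = p} {q = q} S S′ f≗f′ i with swapView p q i
... | first         = trans (S .Swapped.hp) (sym (S′ .Swapped.hp))
... | second        = trans (S .Swapped.hq) (sym (S′ .Swapped.hq))
... | other i≢p i≢q = trans (S .Swapped.same i≢p i≢q) (trans (f≗f′ i) (sym (S′ .Swapped.same i≢p i≢q)))

nextFixed-unique : {h h′ : Fin n → Fin n} {p q q′ : Fin n} →
                   NextFixed h p q → NextFixed h′ p q′ → h ≗ h′ → q ≡ q′
nextFixed-unique {q = q} {q′ = q′} (p<q , hq , q-min) (p<q′ , hq′ , q′-min) h≗h′ = Fin.≤-antisym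
  (q-min p<q′ (trans (h≗h′ q′) hq′))
  (q′-min p<q (trans (sym (h≗h′ q)) hq))

nextFixed-exists : (h : Fin n → Fin n) {p i : Fin n} → p < i → h i ≡ i → ∃ (NextFixed h p)
nextFixed-exists h {p} {i} p<i hi≡i
  with least (λ j → p Fin.<? j ×-dec h j Fin.≟ j) (i , p<i , hi≡i)
... | q , (p<q , hq≡q) , minimal = q , p<q , hq≡q , λ p<j hj≡j → minimal (p<j , hj≡j)

-- Encoding permutations by words.

-- The constructors relate permutations instead of building them, so that Encodes
-- is stable under pointwise equality.
data Encodes : Word → ∀ {n} → Fin (suc n) → Permutation′ n → Set where
  empty : {π : Permutation′ 0} → Encodes [] zero π
  push  : ∀ {w} {p : Fin (suc n)} {π σ} → Encodes w p π →
          Inserted p (π ⟨$⟩ʳ_) (σ ⟨$⟩ʳ_) → Encodes (w ∷ʳ x) (inject₁ p) σ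
  pop   : ∀ {w} {p q : Fin (suc n)} {π τ σ} → Encodes w p π →
          Inserted p (π ⟨$⟩ʳ_) (τ ⟨$⟩ʳ_) → NextFixed (τ ⟨$⟩ʳ_) p q →
          Swapped p q (τ ⟨$⟩ʳ_) (σ ⟨$⟩ʳ_) → Encodes (w ∷ʳ x̄) (suc p) σ

encodes⇒pivoted : ∀ {w} {p : Fin (suc n)} {π} → Encodes w p π → Pivoted (toℕ p) (π ⟨$⟩ʳ_)
encodes⇒pivoted empty = pivoted-empty
encodes⇒pivoted (push {p = p} E I) = subst (λ a → Pivoted a _) (sym (Fin.toℕ-inject₁ p))
  (insert-pivoted I (encodes⇒pivoted E))
encodes⇒pivoted (pop E I N S) = swap-pivoted S (insert-pivoted I (encodes⇒pivoted E)) N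

-- The last letter is peeled off. A fixed element at the pivot is removed; otherwise the 2-cycle
-- through the element just before the pivot is dissolved first.
encoding-exists : {p : Fin (suc n)} (π : Permutation′ n) → Pivoted (toℕ p) (π ⟨$⟩ʳ_) → ∃[ w ] Encodes w p π
encoding-exists {zero}  {zero} π P = [] , empty
encoding-exists {suc n} {p} π P with Fin.any? (λ s → inject₁ s Fin.≟ p ×-dec π ⟨$⟩ʳ s Fin.≟ s)
encoding-exists {suc n} π P | yes (s , refl , πs≡s) =
  let I     = remove-inserted π πs≡s
      w , E = encoding-exists (remove s π)
                (remove-pivoted I (subst (λ a → Pivoted a _) (Fin.toℕ-inject₁ s) P))
  in w ∷ʳ x , push E I
encoding-exists {suc n} {zero} π P | no moves =
  -- With pivot 0, `above` fixes every element, in particular the one at the pivot.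
  contradiction (zero , refl , P .above z≤n z≤n) moves
encoding-exists {suc n} {suc p} π P | no moves =
  -- The pivot is `suc p`, so `p` is the last element before it, and its partner in the 2-cycle is
  -- its image.
  let q      = π ⟨$⟩ʳ p
      S      = transpose-unswapped (π ⟨$⟩ʳ_) refl (P .involutive p)
      moves′ = λ s s≡1+p πs≡s → moves (s , Fin.toℕ-injective (trans (Fin.toℕ-inject₁ s) s≡1+p) , πs≡s)
      τ      = transpose p q ∘ₚ π
      I      = remove-inserted τ (S .Swapped.hp)
      w , E  = encoding-exists (remove p τ) (remove-pivoted I (unswap-pivoted S P moves′))
  in w ∷ʳ x̄ , pop {τ = τ} E I (unswap-next S P moves′) S

-- Equal permutations have equal pivots, and whether the element there is fixed decides the last
-- letter. The preceding permutations then agree, because insertion and swap are injective.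
encoding-unique : ∀ {w v} {p r : Fin (suc n)} {π ρ} → Encodes w p π → Encodes v r ρ → π ≈ ρ → w ≡ v
encoding-unique E F π≈ρ = go E F π≈ρ
    (pivot-unique (Pivoted-cong π≈ρ (encodes⇒pivoted E)) (encodes⇒pivoted F))
  where
  -- After a `pop` every fixed point lies past `q`, and `q` is at least `p + 1`, so the element at
  -- the new pivot is not fixed.
  clash : {p s q : Fin (suc m)} {h f : Fin (suc m) → Fin (suc m)} → Pivoted (toℕ p) h →
          NextFixed h p q → Swapped p q h f → f s ≡ s → inject₁ s ≢ suc p
  clash {s = s} H N S fs≡s s≡1+p = ℕ.<⇒≱ (swap-fixed⇒> S H N fs≡s)
    (subst (ℕ._≤ _) (trans (sym (cong toℕ s≡1+p)) (Fin.toℕ-inject₁ s)) (proj₁ N))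

  go : ∀ {w v} {p r : Fin (suc n)} {π ρ} → Encodes w p π → Encodes v r ρ → π ≈ ρ → p ≡ r → w ≡ v
  go empty empty _ _ = refl
  go (push E I) (push F J) π≈ρ p≡r with Fin.inject₁-injective p≡r
  ... | refl = cong (_∷ʳ x) (encoding-unique E F (inserted-injective I J π≈ρ))
  -- The partner of `p` is its image, so equal permutations have equal partners.
  go (pop {p = p} E I N S) (pop F J M T) π≈ρ refl
    with trans (sym (S .Swapped.fp)) (trans (π≈ρ p) (T .Swapped.fp))
  ... | refl = cong (_∷ʳ x̄) (encoding-unique E F (inserted-injective I J (swapped-injective S T π≈ρ)))
  go (push {p = p} E I) (pop F J M T) π≈ρ p≡r = contradiction p≡r
    (clash (insert-pivoted J (encodes⇒pivoted F)) M T (trans (sym (π≈ρ p)) (I .fixes-hole)))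
  go (pop E I N S) (push {p = p} F J) π≈ρ p≡r = contradiction (sym p≡r)
    (clash (insert-pivoted I (encodes⇒pivoted E)) N S (trans (π≈ρ p) (J .fixes-hole)))

-- This yields injectivity of the bijection. Each letter determines its step from the previous pivot
-- and permutation; for `pop`, because the next fixed point is unique.
encodes-deterministic : ∀ {w v} {p r : Fin (suc n)} {π ρ} → Encodes w p π → Encodes v r ρ → w ≡ v →
                        p ≡ r × π ≈ ρ
encodes-deterministic empty empty _ = refl , λ ()
encodes-deterministic (push {w = w} E I) (push {w = v} F J) w≡v
  with encodes-deterministic E F (List.∷ʳ-injectiveˡ w v w≡v)
... | refl , π≈ρ = refl , inserted-cong I J π≈ρ
encodes-deterministic (pop {w = w} E I N S) (pop {w = v} F J M T) w≡v
  with encodes-deterministic E F (List.∷ʳ-injectiveˡ w v w≡v)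
... | refl , π≈ρ with inserted-cong I J π≈ρ
... | τ≈τ′ with nextFixed-unique N M τ≈τ′
... | refl = refl , swapped-cong S T τ≈τ′
encodes-deterministic (push {w = w} _ _) (pop {w = v} _ _ _ _) w≡v with () ← List.∷ʳ-injectiveʳ w v w≡v
encodes-deterministic (pop {w = w} _ _ _ _) (push {w = v} _ _) w≡v with () ← List.∷ʳ-injectiveʳ w v w≡v

-- Counting fixed points and letters.

indicator : {A : Set} → Dec A → ℕ
indicator (yes _) = 1
indicator (no  _) = 0

indicator-yes : {A : Set} → A → (a? : Dec A) → indicator a? ≡ 1
indicator-yes a (yes _) = refl
indicator-yes a (no ¬a) = contradiction a ¬a

indicator-no : {A : Set} → ¬ A → (a? : Dec A) → indicator a? ≡ 0
indicator-no ¬a (yes a) = contradiction a ¬a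
indicator-no ¬a (no _)  = refl

indicator-cong : {A B : Set} → (A → B) → (B → A) → (a? : Dec A) (b? : Dec B) → indicator a? ≡ indicator b?
indicator-cong to from (yes a) b? = sym (indicator-yes (to a) b?)
indicator-cong to from (no ¬a) b? = sym (indicator-no (¬a ∘ from) b?)

-- A sum over `Fin` rather than the length of a list, so that `sum-remove` can split off the term at
-- an inserted point.
countFixed : (Fin n → Fin n) → ℕ
countFixed f = sum (λ i → indicator (f i Fin.≟ i))

length-filter-tabulate : {A : Set} {P : A → Set} (P? : Decidable P) (f : Fin n → A) →
                         length (filter P? (tabulate f)) ≡ sum (λ i → indicator (P? (f i)))
length-filter-tabulate {zero}  P? f = refl
length-filter-tabulate {suc n} P? f with P? (f zero)
... | yes _ = cong suc (length-filter-tabulate P? (f ∘ suc))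
... | no  _ = length-filter-tabulate P? (f ∘ suc)

fixedPoints≡countFixed : (π : Permutation′ n) → fixedPoints π ≡ countFixed (π ⟨$⟩ʳ_)
fixedPoints≡countFixed π = length-filter-tabulate (λ i → π ⟨$⟩ʳ i Fin.≟ i) (λ i → i)

countFixed-inserted : {p : Fin (suc n)} → Inserted p f g → countFixed g ≡ suc (countFixed f)
countFixed-inserted {f = f} {g = g} {p = p} I = trans
  (sum-remove {i = p} (λ i → indicator (g i Fin.≟ i)))
  (cong₂ _+_ (indicator-yes (I .fixes-hole) (g p Fin.≟ p))
    (sum-cong-≗ λ i → indicator-cong
      (λ gei≡ei → Fin.punchIn-injective p _ _ (trans (sym (I .on-punched i)) gei≡ei))
      (λ fi≡i → trans (I .on-punched i) (cong (punchIn p) fi≡i))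
      (g (punchIn p i) Fin.≟ punchIn p i) (f i Fin.≟ i)))

sum-indicator-≡ : (p : Fin n) → sum (λ i → indicator (i Fin.≟ p)) ≡ 1
sum-indicator-≡ {suc n} p = trans
  (sum-remove {i = p} (λ i → indicator (i Fin.≟ p)))
  (cong₂ _+_ (indicator-yes refl (p Fin.≟ p))
    (trans (sum-cong-≗ λ i → indicator-no (Fin.punchInᵢ≢i p i) (punchIn p i Fin.≟ p))
      (sum-replicate-zero n)))

-- `h` fixes the same points as `f` and also `p` and `q`, so the indicators differ pointwise by
-- those of these two points.
countFixed-swapped : p ≢ q → Swapped p q h f → countFixed h ≡ countFixed f + 2
countFixed-swapped {p = p} {q = q} {h = h} {f = f} p≢q S = begin
  sum fixedʰ
    ≡⟨ sum-cong-≗ pointwise ⟩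
  sum (λ i → fixedᶠ i + (atᵖ i + at𐞥 i))
    ≡⟨ ∑-distrib-+ fixedᶠ (λ i → atᵖ i + at𐞥 i) ⟩
  sum fixedᶠ + sum (λ i → atᵖ i + at𐞥 i)
    ≡⟨ cong (λ l → sum fixedᶠ + l) (∑-distrib-+ atᵖ at𐞥) ⟩
  sum fixedᶠ + (sum atᵖ + sum at𐞥)
    ≡⟨ cong (λ l → sum fixedᶠ + l) (cong₂ _+_ (sum-indicator-≡ p) (sum-indicator-≡ q)) ⟩
  sum fixedᶠ + 2
    ∎
  where
  open ≡-Reasoning
  open Swapped S
  fixedʰ = λ i → indicator (h i Fin.≟ i)
  fixedᶠ = λ i → indicator (f i Fin.≟ i)
  atᵖ = λ i → indicator (i Fin.≟ p)
  at𐞥 = λ i → indicator (i Fin.≟ q)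

  pointwise : ∀ i → fixedʰ i ≡ fixedᶠ i + (atᵖ i + at𐞥 i)
  pointwise i with swapView p q i
  ... | first = trans (indicator-yes hp (h p Fin.≟ p)) (sym (cong₂ _+_
    (indicator-no (λ fp≡p → p≢q (trans (sym fp≡p) fp)) (f p Fin.≟ p))
    (cong₂ _+_ (indicator-yes refl (p Fin.≟ p)) (indicator-no p≢q (p Fin.≟ q)))))
  ... | second = trans (indicator-yes hq (h q Fin.≟ q)) (sym (cong₂ _+_
    (indicator-no (λ fq≡q → p≢q (trans (sym fq) fq≡q)) (f q Fin.≟ q))
    (cong₂ _+_ (indicator-no (p≢q ∘ sym) (q Fin.≟ p)) (indicator-yes refl (q Fin.≟ q)))))
  ... | other i≢p i≢q = trans
    (indicator-cong (trans (sym (same i≢p i≢q))) (trans (same i≢p i≢q)) (h i Fin.≟ i) (f i Fin.≟ i))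
    (trans (sym (ℕ.+-identityʳ _)) (cong (λ l → fixedᶠ i + l) (sym (cong₂ _+_
      (indicator-no i≢p (i Fin.≟ p)) (indicator-no i≢q (i Fin.≟ q))))))

count-∷ʳ : ∀ w c a → ∣ w ∷ʳ c ∣[ a ] ≡ ∣ w ∣[ a ] + ∣ c ∷ [] ∣[ a ]
count-∷ʳ w c a = trans (cong length (List.filter-++ (Defs._≟ a) w (c ∷ [])))
  (List.length-++ (filter (Defs._≟ a) w))

-- The additive form avoids subtraction and also shows that the surplus of `x` over `x̄` is never
-- negative. A `push` adds one fixed point; a `pop` inserts one and then loses two.
encodes-balance : ∀ {w} {p : Fin (suc n)} {π} → Encodes w p π →
                  countFixed (π ⟨$⟩ʳ_) + ∣ w ∣[ x̄ ] ≡ ∣ w ∣[ x ]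
encodes-balance empty = refl
encodes-balance (push {w = w} {π = π} {σ = σ} E I) = begin
  countFixed (σ ⟨$⟩ʳ_) + ∣ w ∷ʳ x ∣[ x̄ ]
    ≡⟨ cong₂ _+_ (countFixed-inserted I) (count-∷ʳ w x x̄) ⟩
  suc (countFixed (π ⟨$⟩ʳ_)) + (∣ w ∣[ x̄ ] + 0)
    ≡⟨ rearrange (countFixed (π ⟨$⟩ʳ_)) ∣ w ∣[ x̄ ] ⟩
  countFixed (π ⟨$⟩ʳ_) + ∣ w ∣[ x̄ ] + 1
    ≡⟨ cong (_+ 1) (encodes-balance E) ⟩
  ∣ w ∣[ x ] + 1
    ≡⟨ count-∷ʳ w x x ⟨
  ∣ w ∷ʳ x ∣[ x ]
    ∎
  where
  open ≡-Reasoning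
  rearrange : ∀ k l → suc k + (l + 0) ≡ k + l + 1
  rearrange = solve-∀
-- The extra `suc` makes room for comparing `countFixed` of `σ` plus 2 with `countFixed` of `π` plus
-- 1; both count the fixed points of `τ`.
encodes-balance (pop {w = w} {π = π} {τ = τ} {σ = σ} E I N S) = ℕ.suc-injective (begin
  suc (countFixed (σ ⟨$⟩ʳ_) + ∣ w ∷ʳ x̄ ∣[ x̄ ])
    ≡⟨ cong (λ l → suc (countFixed (σ ⟨$⟩ʳ_) + l)) (count-∷ʳ w x̄ x̄) ⟩
  suc (countFixed (σ ⟨$⟩ʳ_) + (∣ w ∣[ x̄ ] + 1))
    ≡⟨ rearrange (countFixed (σ ⟨$⟩ʳ_)) ∣ w ∣[ x̄ ] ⟩
  countFixed (σ ⟨$⟩ʳ_) + 2 + ∣ w ∣[ x̄ ]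
    ≡⟨ cong (_+ ∣ w ∣[ x̄ ]) (trans (sym (countFixed-swapped p≢q S)) (countFixed-inserted I)) ⟩
  suc (countFixed (π ⟨$⟩ʳ_) + ∣ w ∣[ x̄ ])
    ≡⟨ cong suc (encodes-balance E) ⟩
  suc ∣ w ∣[ x ]
    ≡⟨ cong suc (trans (count-∷ʳ w x̄ x) (ℕ.+-identityʳ _)) ⟨
  suc ∣ w ∷ʳ x̄ ∣[ x ]
    ∎)
  where
  open ≡-Reasoning
  p≢q = Fin.<⇒≢ (proj₁ N)
  rearrange : ∀ k l → suc (k + (l + 1)) ≡ k + 2 + l
  rearrange = solve-∀

-- Encodings give exactly the ballot words.

length-∷ʳ : {A : Set} (ys : List A) {y : A} → length (ys ∷ʳ y) ≡ suc (length ys)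
length-∷ʳ ys = trans (List.length-++ ys) (ℕ.+-comm (length ys) 1)

encodes⇒length : ∀ {w} {p : Fin (suc n)} {π} → Encodes w p π → length w ≡ n
encodes⇒length empty = refl
encodes⇒length (push {w = w} E _) = trans (length-∷ʳ w) (cong suc (encodes⇒length E))
encodes⇒length (pop {w = w} E _ _ _) = trans (length-∷ʳ w) (cong suc (encodes⇒length E))

-- A prefix of `w ∷ʳ c` is either the whole word, covered by the height hypothesis, or a prefix of
-- `w`.
primitiveDyck-∷ʳ : ∀ {w c} → IsPrimitiveDyck w → ∣ w ∷ʳ c ∣[ x ] ℕ.≥ ∣ w ∷ʳ c ∣[ x̄ ] → IsPrimitiveDyck (w ∷ʳ c)
primitiveDyck-∷ʳ {w} {c} D height u v wc≡uv with initLast v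
... | []       = subst (λ t → ∣ t ∣[ x ] ℕ.≥ ∣ t ∣[ x̄ ]) (trans wc≡uv (List.++-identityʳ u)) height
... | v′ ∷ʳ′ d = D u v′ (List.∷ʳ-injectiveˡ w (u ++ v′)
  (trans wc≡uv (sym (List.++-assoc u v′ (d ∷ [])))))

primitiveDyck-++ˡ : ∀ {w} v → IsPrimitiveDyck (w ++ v) → IsPrimitiveDyck w
primitiveDyck-++ˡ v D u u′ w≡uu′ = D u (u′ ++ v) (trans (cong (_++ v) w≡uu′) (List.++-assoc u u′ v))

encodes⇒primitiveDyck : ∀ {w} {p : Fin (suc n)} {π} → Encodes w p π → IsPrimitiveDyck w
encodes⇒primitiveDyck empty [] [] refl = z≤n
encodes⇒primitiveDyck E@(push E′ _) = primitiveDyck-∷ʳ (encodes⇒primitiveDyck E′)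
  (ℕ.m+n≤o⇒n≤o _ (ℕ.≤-reflexive (encodes-balance E)))
encodes⇒primitiveDyck E@(pop E′ _ _ _) = primitiveDyck-∷ʳ (encodes⇒primitiveDyck E′)
  (ℕ.m+n≤o⇒n≤o _ (ℕ.≤-reflexive (encodes-balance E)))

countFixed>0⇒fixed : (f : Fin n → Fin n) → 0 ℕ.< countFixed f → ∃[ i ] f i ≡ i
countFixed>0⇒fixed {n} f 0<count with Fin.any? (λ i → f i Fin.≟ i)
... | yes fixed = fixed
... | no  none  = contradiction
  (trans (sum-cong-≗ λ i → indicator-no (λ fi≡i → none (i , fi≡i)) (f i Fin.≟ i)) (sum-replicate-zero n))
  (ℕ.>⇒≢ 0<count)

decoding-exists : ∀ {w} → length w ≡ n → IsPrimitiveDyck w →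
                  Σ[ p ∈ Fin (suc n) ] Σ[ π ∈ Permutation′ n ] Encodes w p π
decoding-exists {zero}  {[]} _ _ = zero , id , empty
decoding-exists {suc n} {w} ∣w∣≡1+n D with initLast w
... | w′ ∷ʳ′ c with decoding-exists {n} {w′}
                      (ℕ.suc-injective (trans (sym (length-∷ʳ w′)) ∣w∣≡1+n))
                      (primitiveDyck-++ˡ (c ∷ []) D)
decoding-exists _ D | w′ ∷ʳ′ x | p , π , E = inject₁ p , insert p p π , push E (insert-inserted p π)
decoding-exists _ D | w′ ∷ʳ′ x̄ | p , π , E =
  -- Any fixed point of `π` lies at or after the pivot, so inserting at `p` pushes it past `p`.
  -- Hence a next fixed point exists to be joined.
  let i , πi≡i = countFixed>0⇒fixed (π ⟨$⟩ʳ_) 0<count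
      τ = insert p p π
      I = insert-inserted p π
      p<ei = punchIn-> p (fixed⇒above (encodes⇒pivoted E) πi≡i)
      q , N = nextFixed-exists (τ ⟨$⟩ʳ_) p<ei (trans (I .on-punched i) (cong (punchIn p) πi≡i))
  in suc p , transpose p q ∘ₚ τ ,
     pop {τ = τ} E I N (transpose-swapped (τ ⟨$⟩ʳ_) (I .fixes-hole) (proj₁ (proj₂ N)))
  where
  -- The prefix condition at the whole word: before the final `x̄`, the letter `x` is strictly
  -- ahead, and by the balance `π` has a fixed point.
  height : ∣ w′ ∣[ x̄ ] + 1 ℕ.≤ ∣ w′ ∣[ x ] + 0
  height = subst₂ ℕ._≤_ (count-∷ʳ w′ x̄ x̄) (count-∷ʳ w′ x̄ x) (D (w′ ∷ʳ x̄) [] (sym (List.++-identityʳ _)))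

  0<count : 0 ℕ.< countFixed (π ⟨$⟩ʳ_)
  0<count = ℕ.+-cancelˡ-≤ ∣ w′ ∣[ x̄ ] 1 _ (ℕ.≤-trans height (ℕ.≤-reflexive
    (trans (ℕ.+-identityʳ _) (trans (sym (encodes-balance E)) (ℕ.+-comm _ ∣ w′ ∣[ x̄ ])))))

-- Pattern avoidance as inequalities, and the bijection.

avoids⇒avoiding : (π : Permutation′ n) → Avoids π pattern132 →
                  ∀ {i j k} → i < j → j < k → π ⟨$⟩ʳ i < π ⟨$⟩ʳ k → π ⟨$⟩ʳ k < π ⟨$⟩ʳ j → ⊥
avoids⇒avoiding {n} π av {i} {j} {k} i<j j<k πi<πk πk<πj = av (ι , (λ {a} {b} → mono a b) , iso)
  where
  ι : Fin 3 → Fin n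
  ι 0F = i
  ι 1F = j
  ι 2F = k

  mono : ∀ a b → a < b → ι a < ι b
  mono 0F 1F _ = i<j
  mono 0F 2F _ = ℕ.<-trans i<j j<k
  mono 1F 2F _ = j<k
  mono 1F 1F (s≤s ())
  mono 2F 1F (s≤s ())
  mono 2F 2F (s≤s (s≤s ()))

  true⇔ : {A B : Set} → A → B → A ⇔ B
  true⇔ a b = mk⇔ (λ _ → b) (λ _ → a)

  false⇔ : {A B : Set} → ¬ A → ¬ B → A ⇔ B
  false⇔ ¬a ¬b = mk⇔ (λ a → contradiction a ¬a) (λ b → contradiction b ¬b)

  πi<πj = ℕ.<-trans πi<πk πk<πj

  iso : OrderIsomorphic ((π ⟨$⟩ʳ_) ∘ ι) (pattern132 ⟨$⟩ʳ_)
  iso 0F 0F = false⇔ (ℕ.<-irrefl refl) (λ ())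
  iso 0F 1F = true⇔ πi<πj z<s
  iso 0F 2F = true⇔ πi<πk z<s
  iso 1F 0F = false⇔ (ℕ.<-asym πi<πj) (λ ())
  iso 1F 1F = false⇔ (ℕ.<-irrefl refl) (ℕ.<-irrefl refl)
  iso 1F 2F = false⇔ (ℕ.<-asym πk<πj) (λ { (s≤s ()) })
  iso 2F 0F = false⇔ (ℕ.<-asym πi<πk) (λ ())
  iso 2F 1F = true⇔ πk<πj (s≤s z<s)
  iso 2F 2F = false⇔ (ℕ.<-irrefl refl) (ℕ.<-irrefl refl)

avoiding⇒avoids : (π : Permutation′ n) →
                  (∀ {i j k} → i < j → j < k → π ⟨$⟩ʳ i < π ⟨$⟩ʳ k → π ⟨$⟩ʳ k < π ⟨$⟩ʳ j → ⊥) →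
                  Avoids π pattern132
avoiding⇒avoids π av (ι , mono , iso) = av
  (mono {0F} {1F} z<s) (mono {1F} {2F} (s≤s z<s))
  (Equivalence.from (iso 0F 2F) z<s) (Equivalence.from (iso 2F 1F) (s≤s z<s))

encoding : (α : AvoidingInvolution n) → ∃[ w ] ∃[ p ] Encodes w p (perm α)
encoding α =
  let p , P = pivot-exists (perm α ⟨$⟩ʳ_) (involution α) (avoids⇒avoiding (perm α) (avoids α))
      w , E = encoding-exists (perm α) P
  in w , p , E

encode : AvoidingInvolution n → PrimitiveDyckWord n
encode α =
  let w , _ , E = encoding α
  in record { word = w ; length-word = encodes⇒length E ; primitiveDyck = encodes⇒primitiveDyck E }

-- The bijection rests on this fact and its counterpart for `decode`; how the word was found does
-- not matter.
encode-encodes : (α : AvoidingInvolution n) → Encodes (word (encode α)) _ (perm α)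
encode-encodes α = proj₂ (proj₂ (encoding α))

decode : PrimitiveDyckWord n → AvoidingInvolution n
decode w =
  let _ , π , E = decoding-exists (length-word w) (primitiveDyck w)
  in record
    { perm       = π
    ; involution = encodes⇒pivoted E .involutive
    ; avoids     = avoiding⇒avoids π (encodes⇒pivoted E .avoiding)
    }

decode-encodes : (w : PrimitiveDyckWord n) → Encodes (word w) _ (perm (decode w))
decode-encodes w = proj₂ (proj₂ (decoding-exists (length-word w) (primitiveDyck w)))

theorem2p3 : (n : ℕ) →
    Σ[ Φ ∈ Bijection (avoidingInvolutions n) (primitiveDyckWords n) ]
    ((π : AvoidingInvolution n) →
    + fixedPoints (perm π) ≡ + ∣ word (Bijection.to Φ π) ∣[ x ] - + ∣ word (Bijection.to Φ π) ∣[ x̄ ])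
theorem2p3 n = bijection , fixedPoints-encode
  where
  bijection : Bijection (avoidingInvolutions n) (primitiveDyckWords n)
  bijection = record
    { to        = encode
    ; cong      = λ {α} {β} → encoding-unique (encode-encodes α) (encode-encodes β)
    ; bijective =
        (λ {α} {β} w≡v → proj₂ (encodes-deterministic (encode-encodes α) (encode-encodes β) w≡v)) ,
        -- Surjectivity is required for every `α` pointwise equal to `decode w`, which uniqueness of
        -- encodings provides.
        (λ w → decode w , λ {α} → encoding-unique (encode-encodes α) (decode-encodes w))
    }

  fixedPoints-encode : (α : AvoidingInvolution n) →
    + fixedPoints (perm α) ≡ + ∣ word (encode α) ∣[ x ] - + ∣ word (encode α) ∣[ x̄ ]
  fixedPoints-encode α = begin
    + fixedPoints (perm α)            ≡⟨ cong +_ (fixedPoints≡countFixed (perm α)) ⟩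
    -- Truncated subtraction is exact here, since `b ≤ k + b`, so it can be passed to the integers.
    + k                               ≡⟨ cong +_ (ℕ.m+n∸n≡m k b) ⟨
    + (k + b ℕ.∸ b)                   ≡⟨ ℤ.⊖-≥ (ℕ.m≤n+m b k) ⟨
    (k + b) ⊖ b                       ≡⟨ ℤ.m-n≡m⊖n (k + b) b ⟨
    + (k + b) - + b                   ≡⟨ cong (λ l → + l - + b) (encodes-balance (encode-encodes α)) ⟩
    + ∣ word (encode α) ∣[ x ] - + b  ∎
    where
    open ≡-Reasoning
    k = countFixed (perm α ⟨$⟩ʳ_)
    b = ∣ word (encode α) ∣[ x̄ ]
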